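{- There exists a polynomial $p$ such that for every sufficiently large natural number $n$ the following holds. Let $\alpha$ be an integer with $\alpha > 7 \log n + 6$, and let $(x_1, \ldots, x_t)$ be a tuple of strings in $\{0,1\}^n$ that is mutually $\alpha$-independent, i.e. $C(x_{\pi(1)} x_{\pi(2)} \cdots x_{\pi(t)}) \geq C(x_1) + \cdots + C(x_t) - \alpha$ for every permutation $\pi$ of $\{1,\ldots,t\}$. Then $t \leq p(n)\, 2^{\alpha}$.
   Context: $C(x)$ denotes the plain Kolmogorov complexity of the binary string $x$ with respect to a fixed universal Turing machine; juxtaposition of strings denotes concatenation. Logarithms are base $2$. -}

module Defs where

open import Axiom.ExcludedMiddle using (ExcludedMiddle)
open import Data.Bool.Base using (Bool)
open import Data.Empty using (⊥)
open import Data.Fin.Base using (Fin)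
open import Data.Fin.Permutation using (Permutation′; _⟨$⟩ʳ_)
open import Data.Fin.Properties using (0↔⊥; 1↔⊤)
open import Data.List.Base using (List; []; _∷_; length; map; concat; tabulate; sum; foldr)
open import Data.Maybe.Base using (Maybe; just; nothing)
open import Data.Nat.Base using (ℕ; suc; _+_; _*_; _^_; _≤_; _<_; _>_)
open import Data.Nat.Induction using (<-rec)
open import Data.Nat.Properties using (≮⇒≥)
open import Data.Product.Base using (∃; ∃-syntax; _×_; _,_; proj₁; proj₂)
open import Data.Unit.Base using (⊤; tt)
open import Data.Vec.Base as Vec using (Vec; toList)
open import Function.Bundles using (_↔_)
open import Function.Construct.Symmetry using (↔-sym)
open import Level using (0ℓ)
open import Relation.Binary.PropositionalEquality using (_≡_; refl; cong)
open import Relation.Nullary.Decidable.Core using (yes; no)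

BitString : Set
BitString = List Bool

Finite : Set → Set
Finite A = ∃[ n ] (A ↔ Fin n)

-- Turing machines are deterministic, with any positive number of two-way
-- infinite tapes and any finite tape alphabet containing a blank and both bits.

data Symbol (Γ : Set) : Set where
  blank : Symbol Γ
  bit   : Bool → Symbol Γ
  aux   : Γ → Symbol Γ

data Move : Set where
  left stay right : Move

-- `lefts` lists the cells to the left of the head, nearest first; `rights`
-- those to its right.  All cells beyond the ends of the two lists are blank.
record Tape (Γ : Set) : Set where
  constructor mkTape
  field
    lefts   : List (Symbol Γ)
    scanned : Symbol Γ
    rights  : List (Symbol Γ)

open Tape public

module _ {Γ : Set} where

  blankTape : Tape Γ
  blankTape = mkTape [] blank []

  -- The head is on the first bit.
  inputTape : BitString → Tape Γ
  inputTape []      = blankTape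
  inputTape (b ∷ s) = mkTape [] (bit b) (map bit s)

  move : Move → Tape Γ → Tape Γ
  move stay  t                       = t
  move left  (mkTape []       a rs)  = mkTape [] blank (a ∷ rs)
  move left  (mkTape (l ∷ ls) a rs)  = mkTape ls l (a ∷ rs)
  move right (mkTape ls a [])        = mkTape (a ∷ ls) blank []
  move right (mkTape ls a (r ∷ rs))  = mkTape (a ∷ ls) r rs

  act : Symbol Γ × Move → Tape Γ → Tape Γ
  act (a , m) t = move m (record t { scanned = a })

  leadingBits : List (Symbol Γ) → BitString
  leadingBits (bit b ∷ s) = b ∷ leadingBits s
  leadingBits _           = []

  -- The output starts at the head and ends before the first non-bit.
  readOutput : Tape Γ → BitString
  readOutput t = leadingBits (scanned t ∷ rights t)

record TuringMachine : Set₁ where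
  field
    State       : Set
    stateFinite : Finite State
    Aux         : Set
    auxFinite   : Finite Aux
    extraTapes  : ℕ
    start       : State
    -- `nothing` means that the machine halts.
    δ           : State → Vec (Symbol Aux) (suc extraTapes) →
                  Maybe (State × Vec (Symbol Aux × Move) (suc extraTapes))

  Config : Set
  Config = State × Vec (Tape Aux) (suc extraTapes)

  step : Config → Maybe Config
  step (q , ts) with δ q (Vec.map scanned ts)
  ... | nothing       = nothing
  ... | just (q′ , w) = just (q′ , Vec.zipWith act w ts)

  initial : BitString → Config
  initial p = start , inputTape p Vec.∷ Vec.replicate extraTapes blankTape

  data HaltsAt : Config → Config → Set where
    done : ∀ {c} → step c ≡ nothing → HaltsAt c c
    next : ∀ {c c′ d} → step c ≡ just c′ → HaltsAt c′ d → HaltsAt c d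

  -- The first tape serves both for input and for output.
  result : Config → BitString
  result (_ , ts) = readOutput (Vec.head ts)

_on_outputs_ : TuringMachine → BitString → BitString → Set
M on p outputs x = ∃[ d ] HaltsAt (initial p) d × result d ≡ x
  where open TuringMachine M

IsUniversal : TuringMachine → Set₁
IsUniversal U = ∀ (M : TuringMachine) → ∃[ c ] (∀ p x → M on p outputs x →
  ∃[ q ] (length q ≤ length p + c × U on q outputs x))

HasProgramOfLength : TuringMachine → BitString → ℕ → Set
HasProgramOfLength U x k = ∃[ p ] (length p ≡ k × U on p outputs x)

record IsLeast (P : ℕ → Set) (k : ℕ) : Set where
  field
    holds   : P k
    minimal : ∀ {j} → P j → k ≤ j

identityMachine : TuringMachine
identityMachine = record
  { State       = ⊤
  ; stateFinite = 1 , ↔-sym 1↔⊤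
  ; Aux         = ⊥
  ; auxFinite   = 0 , ↔-sym 0↔⊥
  ; extraTapes  = 0
  ; start       = tt
  ; δ           = λ _ _ → nothing
  }

leadingBits-map-bit : ∀ {Γ : Set} x → leadingBits (map (bit {Γ}) x) ≡ x
leadingBits-map-bit []      = refl
leadingBits-map-bit (b ∷ x) = cong (b ∷_) (leadingBits-map-bit x)

identityMachine-outputs : ∀ x → identityMachine on x outputs x
identityMachine-outputs x = _ , TuringMachine.done refl , output x
  where
  output : ∀ x → readOutput {⊥} (inputTape x) ≡ x
  output []      = refl
  output (b ∷ x) = cong (b ∷_) (leadingBits-map-bit x)

hasProgram : ∀ {U} → IsUniversal U → ∀ x → ∃ (HasProgramOfLength U x)
hasProgram univ x with univ identityMachine
... | _ , simulate with simulate x x (identityMachine-outputs x)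
...   | q , _ , out = length q , q , refl , out

-- Finding least programs, unlike running them, is not effective, so the
-- function C exists only classically.
module _ (em : ExcludedMiddle 0ℓ) where

  least : ∀ (P : ℕ → Set) → ∃ P → ∃ (IsLeast P)
  least P (n , Pn) = <-rec (λ n → P n → ∃ (IsLeast P)) search n Pn
    where
    search : ∀ n → (∀ {m} → m < n → P m → ∃ (IsLeast P)) → P n → ∃ (IsLeast P)
    search n rec Pn with em {∃[ m ] (m < n × P m)}
    ... | yes (m , m<n , Pm) = rec m<n Pm
    ... | no none = n , record
      { holds   = Pn
      ; minimal = λ Pj → ≮⇒≥ (λ j<n → none (_ , j<n , Pj)) }

  complexity : ∀ (U : TuringMachine) → IsUniversal U → ∀ x →
               ∃ (IsLeast (HasProgramOfLength U x))
  complexity U univ x = least (HasProgramOfLength U x) (hasProgram univ x)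

  C : ∀ (U : TuringMachine) → IsUniversal U → BitString → ℕ
  C U univ x = proj₁ (complexity U univ x)

  C-isLeast : ∀ U (univ : IsUniversal U) x →
              IsLeast (HasProgramOfLength U x) (C U univ x)
  C-isLeast U univ x = proj₂ (complexity U univ x)

MutuallyIndependent : (BitString → ℕ) → ℕ → ∀ {t n} → (Fin t → Vec Bool n) → Set
MutuallyIndependent C α {t} x = ∀ (π : Permutation′ t) →
  sum (tabulate λ i → C (toList (x i)))
    ≤ C (concat (tabulate λ i → toList (x (π ⟨$⟩ʳ i)))) + α

-- α > 7 log₂ n + 6, exponentiated.
_>7log₂_+6 : ℕ → ℕ → Set
α >7log₂ n +6 = 2 ^ α > n ^ 7 * 2 ^ 6

-- Coefficients, constant term first.
Polynomial : Set
Polynomial = List ℕ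

eval : Polynomial → ℕ → ℕ
eval p n = foldr (λ a r → a + n * r) 0 p

{-# OPTIONS --safe #-}

-- Let a program for each string be split into its first two bits and the rest.
-- Sort the strings by the length of the rest and, within one length, by the two
-- bits.  A machine that keeps the current pair (length, two bits) as its state
-- then decodes the concatenation of the sorted strings from a stream in which
-- each string costs the rest of its program and a single 1, and each change of
-- state costs a single 0.  Thus every string saves one bit, while only O(n)
-- changes of state occur, and independence gives t ≤ α + O(n).  Programs
-- shorter than two bits output only finitely many strings, which are excluded
-- for large n.
module Submission where

open import Defs
import Algebra.Properties.CommutativeMonoid.Sum as CommutativeMonoidSum
open import Axiom.ExcludedMiddle using (ExcludedMiddle)
open import Data.Bool.Base using (Bool; true; false; if_then_else_; _∧_)
open import Data.Fin.Base using (Fin; suc)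
open import Data.Fin.Patterns
open import Data.Fin.Permutation using (Permutation′; _⟨$⟩ʳ_; id; lift₀; transpose; _∘ₚ_)
open import Data.Fin.Properties using (1↔⊤; 2↔Bool; +↔⊎; *↔×)
open import Data.List.Base
  using (List; []; _∷_; length; map; _++_; _ʳ++_; reverse; replicate; concat; tabulate)
open import Data.List.Properties
  using (++-identityʳ; ++-ʳ++; map-++; length-++; length-replicate; length-reverse;
         reverse-map; reverse-involutive; ʳ++-defn)
open import Data.List.Relation.Unary.All using (All; []; _∷_)
open import Data.Maybe.Base using (Maybe; just; nothing)
open import Data.Maybe.Properties using (just-injective)
open import Data.Nat.Base using (ℕ; zero; suc; _+_; _*_; _∸_; _^_; _≤_; _<_; _≥_; z≤n; s≤s)
open import Data.Nat.ListAction using (sum)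
open import Data.Nat.Properties
open import Data.Nat.Tactic.RingSolver using (solve-∀)
open import Data.Product.Base using (∃; ∃-syntax; _×_; _,_; proj₁; proj₂)
open import Data.Product.Function.NonDependent.Propositional using (_×-↔_)
open import Data.Sum.Base using (_⊎_; inj₁; inj₂)
open import Data.Sum.Function.Propositional using (_⊎-↔_)
open import Data.Unit.Base using (⊤; tt)
open import Data.Vec.Base as Vec using (Vec; []; _∷_; toList)
open import Data.Vec.Properties using (length-toList)
open import Data.Vec.Relation.Binary.Pointwise.Inductive using (Pointwise; []; _∷_)
open import Data.Vec.Relation.Unary.All as VecAll using ([]; _∷_)
open import Function.Base using (_∘_)
open import Function.Construct.Composition using (_↔-∘_)
open import Function.Construct.Identity using (↔-id)
open import Function.Construct.Symmetry using (↔-sym)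
open import Level using (0ℓ)
open import Relation.Binary.Construct.Closure.ReflexiveTransitive using (Star; ε; _◅_; _◅◅_)
open import Relation.Binary.PropositionalEquality using (_≡_; refl; sym; trans; cong; cong₂; subst)
open import Relation.Nullary.Decidable.Core using (yes; no)
open import Relation.Nullary.Negation using (contradiction)

-- Finite state sets and runs of Turing machines.

Finite-⊎ : ∀ {A B} → Finite A → Finite B → Finite (A ⊎ B)
Finite-⊎ (m , A↔m) (n , B↔n) = m + n , ↔-sym +↔⊎ ↔-∘ (A↔m ⊎-↔ B↔n)

Finite-× : ∀ {A B} → Finite A → Finite B → Finite (A × B)
Finite-× (m , A↔m) (n , B↔n) = m * n , ↔-sym *↔× ↔-∘ (A↔m ×-↔ B↔n)

module Execution (M : TuringMachine) where
  open TuringMachine M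

  _⟶_ _⟶*_ : Config → Config → Set
  c ⟶ d = step c ≡ just d
  _⟶*_ = Star _⟶_

  ⟶*-halts : ∀ {c d f} → c ⟶* d → HaltsAt d f → HaltsAt c f
  ⟶*-halts ε        h = h
  ⟶*-halts (s ◅ ss) h = next s (⟶*-halts ss h)

  -- `step` branches on `δ` by `with` and is stuck while the outcome of `δ` is abstract. This lemma
  -- and the two eliminators after it reduce facts about `step` to equations on `δ`.
  ⟶-intro : ∀ {q ts q′ w ts′} → δ q (Vec.map scanned ts) ≡ just (q′ , w) →
            Vec.zipWith act w ts ≡ ts′ → (q , ts) ⟶ (q′ , ts′)
  ⟶-intro eq refl rewrite eq = refl

  ⟶-elim : ∀ {q ts q′ ts′} → (q , ts) ⟶ (q′ , ts′) →
           ∃[ w ] (δ q (Vec.map scanned ts) ≡ just (q′ , w) × Vec.zipWith act w ts ≡ ts′)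
  ⟶-elim {q} {ts} s with δ q (Vec.map scanned ts) | s
  ... | just (_ , w) | refl = w , refl , refl

  halted-elim : ∀ {q ts} → step (q , ts) ≡ nothing → δ q (Vec.map scanned ts) ≡ nothing
  halted-elim {q} {ts} s with δ q (Vec.map scanned ts)
  ... | nothing = refl

  HaltsAt-deterministic : ∀ {c d d′} → HaltsAt c d → HaltsAt c d′ → d ≡ d′
  HaltsAt-deterministic (done _)   (done _)    = refl
  HaltsAt-deterministic (done s)   (next s′ _) with () ← trans (sym s) s′
  HaltsAt-deterministic (next s _) (done s′)   with () ← trans (sym s) s′
  HaltsAt-deterministic (next s h) (next s′ h′)
    with refl ← just-injective (trans (sym s) s′) = HaltsAt-deterministic h h′

outputs-deterministic : ∀ {M p x y} → M on p outputs x → M on p outputs y → x ≡ y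
outputs-deterministic {M} (_ , h , refl) (_ , h′ , refl) =
  cong (TuringMachine.result M) (Execution.HaltsAt-deterministic M h h′)

-- Keys and the format of streams.

Prefix : Set
Prefix = Bool × Bool

Key : Set
Key = ℕ × Prefix

succPrefix : Prefix → Prefix
succPrefix (false , false) = false , true
succPrefix (false , true)  = true  , false
succPrefix (true  , false) = true  , true
succPrefix (true  , true)  = false , false

succKey : Key → Key
succKey (ℓ , true  , true) = suc ℓ , false , false
succKey (ℓ , w)            = ℓ , succPrefix w

-- In a stream, 0 passes to the next key and 1 announces a program, which is
-- the current prefix followed by `length` further bits, listed in reverse.
data Decodes (U : TuringMachine) : Key → BitString → BitString → Set where
  end     : ∀ {k} → Decodes U k [] []
  advance : ∀ {k s y} → Decodes U (succKey k) s y → Decodes U k (false ∷ s) y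
  program : ∀ {w₁ w₂ r x s y} → U on w₁ ∷ w₂ ∷ r outputs x →
            Decodes U (length r , w₁ , w₂) s y →
            Decodes U (length r , w₁ , w₂) (true ∷ reverse r ++ s) (x ++ y)

-- The decoding machine.

module Decoder (U : TuringMachine) where
  private module U = TuringMachine U

  Sym : Set
  Sym = Symbol (U.Aux ⊎ ⊤)

  Cells : Set
  Cells = List Sym

  pattern mark = aux (inj₂ tt)

  -- Blanks written by U are marked, so that on each tape the cells visited by U
  -- form one non-blank interval and can be found again for erasing.
  mask : Symbol U.Aux → Sym
  mask blank   = mark
  mask (bit b) = bit b
  mask (aux a) = aux (inj₁ a)

  unmask : Sym → Symbol U.Aux
  unmask blank          = blank
  unmask (bit b)        = bit b
  unmask (aux (inj₁ a)) = aux a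
  unmask mark           = blank

  isBlank : Sym → Bool
  isBlank blank = true
  isBlank _     = false

  allBlank : ∀ {k} → Vec Sym k → Bool
  allBlank []       = true
  allBlank (a ∷ as) = isBlank a ∧ allBlank as

  -- A tape whose head is on a blank idles, so that tapes needing different times can be swept in
  -- one phase until `allBlank` holds.
  rewindAct eraseAct : Sym → Sym × Move
  rewindAct blank = blank , stay
  rewindAct a     = a , left
  eraseAct  blank = blank , stay
  eraseAct  _     = blank , right

  keep : Sym → Sym × Move
  keep a = a , stay

  Phase : Set
  Phase = U.State ⊎ Fin 8

  pattern run q   = inj₁ q
  pattern main    = inj₂ 0F
  pattern load    = inj₂ 1F
  pattern load′   = inj₂ 2F
  pattern copy    = inj₂ 3F
  pattern rewind  = inj₂ 4F
  pattern erase   = inj₂ 5F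
  pattern flush   = inj₂ 6F
  pattern stopped = inj₂ 7F

  Tapes : ℕ
  Tapes = 4 + U.extraTapes

  Action : Set
  Action = Maybe ((Prefix × Phase) × Vec (Sym × Move) Tapes)

  -- Only the passage from prefix 11 to 00 raises the length; the new unary digit goes onto the
  -- blank under the head, which then moves left of it again.
  tally : Prefix → Sym → Sym × Move
  tally (true , true) _ = bit true , left
  tally _             l = keep l

  -- Taking the outcome of `U.δ` as an argument lets `run-halts` rewrite it by `cong`.
  runAction : Prefix → Sym → Sym → Sym → Vec Sym (suc U.extraTapes) →
              Maybe (U.State × Vec (Symbol U.Aux × Move) (suc U.extraTapes)) → Action
  runAction w i o l us nothing         =
    just ((w , copy) , keep i ∷ keep o ∷ keep l ∷ Vec.map keep us)
  runAction w i o l us (just (q , as)) =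
    just ((w , run q) , keep i ∷ keep o ∷ keep l ∷ Vec.map (λ (a , m) → mask a , m) as)

  -- The tapes are: input; the outputs collected so far; the length component
  -- of the key, in unary, with the head just left of it; and the tapes of U.
  δ : Prefix × Phase → Vec Sym Tapes → Action
  δ (w , main) (bit true ∷ o ∷ l ∷ us) =
    just ((w , load) , (bit true , right) ∷ keep o ∷ (l , right) ∷ Vec.map keep us)
  δ (w , main) (bit false ∷ o ∷ l ∷ us) =
    just ((succPrefix w , main) , (bit false , right) ∷ keep o ∷ tally w l ∷ Vec.map keep us)
  δ (w , main) (i ∷ o ∷ l ∷ us) =
    just ((w , flush) , keep i ∷ (o , left) ∷ keep l ∷ Vec.map keep us)
  δ (w , load) (i ∷ o ∷ blank ∷ u ∷ us) =
    just ((w , load′) , keep i ∷ keep o ∷ (blank , left) ∷ (bit (proj₂ w) , left) ∷ Vec.map keep us)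
  δ (w , load) (bit b ∷ o ∷ l ∷ u ∷ us) =
    just ((w , load) , (bit b , right) ∷ keep o ∷ (l , right) ∷ (bit b , left) ∷ Vec.map keep us)
  δ (w , load) _ = nothing
  δ (w , load′) (i ∷ o ∷ l ∷ u ∷ us) =
    just ((w , run U.start) , keep i ∷ keep o ∷ keep l ∷ keep (bit (proj₁ w)) ∷ Vec.map keep us)
  δ (w , run q) (i ∷ o ∷ l ∷ us) = runAction w i o l us (U.δ q (Vec.map unmask us))
  δ (w , copy) (i ∷ o ∷ l ∷ bit b ∷ us) =
    just ((w , copy) , keep i ∷ (bit b , right) ∷ keep l ∷ (bit b , right) ∷ Vec.map keep us)
  δ (w , copy) (i ∷ o ∷ l ∷ us) =
    just ((w , rewind) , keep i ∷ keep o ∷ keep l ∷ Vec.map (λ _ → keep mark) us)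
  δ (w , rewind) (i ∷ o ∷ ts) =
    if allBlank ts
    then just ((w , erase) , keep i ∷ keep o ∷ keep (Vec.head ts) ∷ Vec.map (_, right) (Vec.tail ts))
    else just ((w , rewind) , keep i ∷ keep o ∷ Vec.map rewindAct ts)
  δ (w , erase) (i ∷ o ∷ l ∷ us) =
    if allBlank us
    then just ((w , main) , keep i ∷ keep o ∷ keep l ∷ Vec.map keep us)
    else just ((w , erase) , keep i ∷ keep o ∷ keep l ∷ Vec.map eraseAct us)
  δ (w , flush) (i ∷ bit b ∷ l ∷ us) =
    just ((w , flush) , (bit b , left) ∷ (bit b , left) ∷ keep l ∷ Vec.map keep us)
  δ (w , flush) (i ∷ o ∷ l ∷ us) =
    just ((w , stopped) , (i , right) ∷ keep o ∷ keep l ∷ Vec.map keep us)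
  δ (w , stopped) _ = nothing

  decoder : TuringMachine
  decoder = record
    { State       = Prefix × Phase
    ; stateFinite = Finite-× (Finite-× finiteBool finiteBool)
                             (Finite-⊎ U.stateFinite (8 , ↔-id _))
    ; Aux         = U.Aux ⊎ ⊤
    ; auxFinite   = Finite-⊎ U.auxFinite (1 , ↔-sym 1↔⊤)
    ; extraTapes  = 3 + U.extraTapes
    ; start       = (false , false) , main
    ; δ           = δ
    }
    where
    finiteBool : Finite Bool
    finiteBool = 2 , ↔-sym 2↔Bool

  open TuringMachine decoder using (Config; step; done; result)
  open Execution decoder
  private module UE = Execution U

  -- Tape invariants and the simulation of `U`.

  Tape′ : Set
  Tape′ = Tape (U.Aux ⊎ ⊤)

  Blanks Inked : Cells → Set
  Blanks = All (_≡ blank)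
  Inked  = All (λ a → isBlank a ≡ false)

  -- One shape serves both for a tape of `U` receiving a program from its last bit on and for the
  -- length tape, where only the length of `v` counts. Explicit blanks are allowed because erasing
  -- and head moves leave them in the lists.
  data Stack (v : BitString) : Tape′ → Set where
    stack : ∀ {bs cs} → Blanks bs → Blanks cs → Stack v (mkTape bs blank (map bit v ++ cs))

  push : ∀ {v t} b → Stack v t → Stack (b ∷ v) (act (bit b , left) t)
  push b (stack []          cs) = stack [] cs
  push b (stack (refl ∷ bs) cs) = stack bs cs

  -- Consumed input stays on the left, unconstrained. At the end nothing lies to the right, so an
  -- output written leftwards from there is followed by no stray bits.
  data Reading : BitString → Tape′ → Set where
    end : ∀ {ls} → Reading [] (mkTape ls blank [])
    at  : ∀ {ls b s} → Reading (b ∷ s) (mkTape ls (bit b) (map bit s))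

  advance-reading : ∀ {ls b} s → Reading s (act (bit b , right) (mkTape ls (bit b) (map bit s)))
  advance-reading []      = end
  advance-reading (_ ∷ _) = at

  inputTape-reading : ∀ s → Reading s (inputTape s)
  inputTape-reading []      = end
  inputTape-reading (_ ∷ _) = at

  -- Every cell that the head has left carries a masked symbol. The scanned cell is related only
  -- through `unmask`, as it may be a genuine blank on a first visit.
  data Simulates : Tape U.Aux → Tape′ → Set where
    simulates : ∀ {ls a rs a′ bs cs} → unmask a′ ≡ a → Blanks bs → Blanks cs →
      Simulates (mkTape ls a rs) (mkTape (map mask ls ++ bs) a′ (map mask rs ++ cs))

  unmask-mask : ∀ a → unmask (mask a) ≡ a
  unmask-mask blank   = refl
  unmask-mask (bit _) = refl
  unmask-mask (aux _) = refl

  unmask-bit : ∀ {a b} → unmask a ≡ bit b → a ≡ bit b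
  unmask-bit {bit _}        refl = refl
  unmask-bit {aux (inj₁ _)} ()
  unmask-bit {mark}         ()

  act-simulates : ∀ {t t′} a m → Simulates t t′ → Simulates (act (a , m) t) (act (mask a , m) t′)
  act-simulates a stay  (simulates _ bs cs) = simulates (unmask-mask a) bs cs
  act-simulates a left  (simulates {ls = l ∷ _} _ bs cs) = simulates (unmask-mask l) bs cs
  act-simulates a left  (simulates {ls = []} _ [] cs) = simulates refl [] cs
  act-simulates a left  (simulates {ls = []} _ (refl ∷ bs) cs) = simulates refl bs cs
  act-simulates a right (simulates {rs = r ∷ _} _ bs cs) = simulates (unmask-mask r) bs cs
  act-simulates a right (simulates {rs = []} _ bs []) = simulates refl bs []
  act-simulates a right (simulates {rs = []} _ bs (refl ∷ cs)) = simulates refl bs cs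

  simulates-scanned : ∀ {k} {ts : Vec _ k} {ts′ : Vec _ k} → Pointwise Simulates ts ts′ →
    Vec.map unmask (Vec.map scanned ts′) ≡ Vec.map scanned ts
  simulates-scanned []                     = refl
  simulates-scanned (simulates eq _ _ ∷ ss) = cong₂ _∷_ eq (simulates-scanned ss)

  zipWith-act-simulates : ∀ {k} {ts : Vec _ k} {ts′ : Vec _ k} (as : Vec _ k) →
    Pointwise Simulates ts ts′ →
    Pointwise Simulates (Vec.zipWith act as ts)
      (Vec.zipWith act (Vec.map (λ (a , m) → mask a , m) as) ts′)
  zipWith-act-simulates []             []       = []
  zipWith-act-simulates ((a , m) ∷ as) (s ∷ ss) = act-simulates a m s ∷ zipWith-act-simulates as ss

  -- On a vector of variable length, writing back the scanned symbols is the identity only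
  -- propositionally; `keep₃` and `keep₄` transport this to whole steps.
  act-keep : ∀ {k} (ts : Vec Tape′ k) → Vec.zipWith act (Vec.map keep (Vec.map scanned ts)) ts ≡ ts
  act-keep []       = refl
  act-keep (t ∷ ts) = cong (t ∷_) (act-keep ts)

  keep₃ : ∀ {c : Prefix × Phase} {t₁ t₂ t₃} (ts : Vec Tape′ (suc U.extraTapes)) →
    _≡_ {A = Maybe Config}
      (just (c , t₁ ∷ t₂ ∷ t₃ ∷ Vec.zipWith act (Vec.map keep (Vec.map scanned ts)) ts))
      (just (c , t₁ ∷ t₂ ∷ t₃ ∷ ts))
  keep₃ {c} ts = cong (λ ts → just (c , _ ∷ _ ∷ _ ∷ ts)) (act-keep ts)

  keep₄ : ∀ {c : Prefix × Phase} {t₁ t₂ t₃ t₄} (ts : Vec Tape′ U.extraTapes) →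
    _≡_ {A = Maybe Config}
      (just (c , t₁ ∷ t₂ ∷ t₃ ∷ t₄ ∷ Vec.zipWith act (Vec.map keep (Vec.map scanned ts)) ts))
      (just (c , t₁ ∷ t₂ ∷ t₃ ∷ t₄ ∷ ts))
  keep₄ {c} ts = cong (λ ts → just (c , _ ∷ _ ∷ _ ∷ _ ∷ ts)) (act-keep ts)

  run-halts : ∀ {w i o l q ts d us} → U.HaltsAt (q , ts) d → Pointwise Simulates ts us →
    ∃[ us′ ] (Pointwise Simulates (proj₂ d) us′ ×
              ((w , run q) , i ∷ o ∷ l ∷ us) ⟶* ((w , copy) , i ∷ o ∷ l ∷ us′))
  run-halts {w} {i} {o} {l} {q} {us = us} (U.done s) ss = us , ss ,
    ⟶-intro {w , run q} {i ∷ o ∷ l ∷ us}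
      (cong (runAction w _ _ _ _) (trans (cong (U.δ _) (simulates-scanned ss)) (UE.halted-elim s)))
            (cong (λ us → i ∷ o ∷ l ∷ us) (act-keep us)) ◅ ε
  run-halts {w} {i} {o} {l} {q} {us = us} (U.next s h) ss
    with as , eq , refl ← UE.⟶-elim s
    with us′ , ss′ , reach ← run-halts {w} {i} {o} {l} h (zipWith-act-simulates as ss) =
    us′ , ss′ ,
    ⟶-intro {w , run q} {i ∷ o ∷ l ∷ us}
      (cong (runAction w _ _ _ _) (trans (cong (U.δ _) (simulates-scanned ss)) eq)) refl ◅ reach

  -- Rewinding and erasing.

  -- The number bounds the duration of the sweep, so that one bound can serve
  -- for several tapes swept simultaneously.
  data Sweep (g : Sym → Sym × Move) : ℕ → Tape′ → Tape′ → Set where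
    stop : ∀ {n ls rs} → Sweep g n (mkTape ls blank rs) (mkTape ls blank rs)
    go   : ∀ {n t t′ am} → isBlank (scanned t) ≡ false → g (scanned t) ≡ am →
           Sweep g n (act am t) t′ → Sweep g (suc n) t t′

  Swept : (Sym → Sym × Move) → (Tape′ → Set) → Tape′ → Set
  Swept g P t = ∃[ n ] ∃[ t′ ] (Sweep g n t t′ × P t′)

  sweep-weaken : ∀ {g n t t′} m → Sweep g n t t′ → Sweep g (n + m) t t′
  sweep-weaken m stop      = stop
  sweep-weaken m (go a eq sw) = go a eq (sweep-weaken m sw)

  sweep-weakenˡ : ∀ {g n t t′} m → Sweep g n t t′ → Sweep g (m + n) t t′
  sweep-weakenˡ {g} {n} {t} {t′} m sw = subst (λ k → Sweep g k t t′) (+-comm n m) (sweep-weaken m sw)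

  sweeps-weakenˡ : ∀ {g n k} {ts ts′ : Vec _ k} m →
    Pointwise (Sweep g n) ts ts′ → Pointwise (Sweep g (m + n)) ts ts′
  sweeps-weakenˡ m []         = []
  sweeps-weakenˡ m (sw ∷ sws) = sweep-weakenˡ m sw ∷ sweeps-weakenˡ m sws

  swept-all : ∀ {g P k} {ts : Vec _ k} → VecAll.All (Swept g P) ts →
    ∃[ n ] ∃[ ts′ ] (Pointwise (Sweep g n) ts ts′ × VecAll.All P ts′)
  swept-all [] = 0 , [] , [] , []
  swept-all ((n , t′ , sw , p) ∷ as) with m , ts′ , sws , ps ← swept-all as =
    n + m , t′ ∷ ts′ , sweep-weaken m sw ∷ sweeps-weakenˡ n sws , p ∷ ps

  -- Shared by both cleaning phases, with the tapes not swept fixed inside `config`. A phase ends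
  -- for all tapes at once, so `g-blank` makes those already on a blank wait.
  module Sweeping (g : Sym → Sym × Move) (g-blank : g blank ≡ keep blank) {k}
    (config : Vec Tape′ k → Config)
    (config-step : ∀ ts → allBlank (Vec.map scanned ts) ≡ false →
      config ts ⟶ config (Vec.zipWith act (Vec.map g (Vec.map scanned ts)) ts)) where

    finished : ∀ {n j} {ts ts′ : Vec _ j} → Pointwise (Sweep g n) ts ts′ →
      allBlank (Vec.map scanned ts) ≡ true → ts ≡ ts′
    finished []          eq = refl
    finished (stop ∷ ss) eq = cong (_ ∷_) (finished ss eq)
    finished (go {t = t} _ _ _ ∷ ss) eq with isBlank (scanned t)
    finished (go () _ _ ∷ ss) eq | true
    finished (go _ _ _ ∷ ss)  () | false

    zero-blank : ∀ {j} {ts ts′ : Vec _ j} → Pointwise (Sweep g 0) ts ts′ →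
      allBlank (Vec.map scanned ts) ≡ true
    zero-blank []          = refl
    zero-blank (stop ∷ ss) = zero-blank ss

    sweep-step : ∀ {n j} {ts ts′ : Vec _ j} → Pointwise (Sweep g (suc n)) ts ts′ →
      Pointwise (Sweep g n) (Vec.zipWith act (Vec.map g (Vec.map scanned ts)) ts) ts′
    sweep-step []          = []
    sweep-step (stop ∷ ss) rewrite g-blank = stop ∷ sweep-step ss
    sweep-step (go _ refl s ∷ ss) = s ∷ sweep-step ss

    sweeps : ∀ n {ts ts′} → Pointwise (Sweep g n) ts ts′ →
      config ts ⟶* config ts′ × allBlank (Vec.map scanned ts′) ≡ true
    sweeps n {ts} ss with allBlank (Vec.map scanned ts) in eq
    sweeps n ss | true with refl ← finished ss eq = ε , eq
    -- An exhausted bound leaves only `stop`, so the test for blanks cannot have failed.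
    sweeps zero ss | false with () ← trans (sym eq) (zero-blank ss)
    sweeps (suc n) {ts} ss | false with reach , eq′ ← sweeps n (sweep-step ss) =
      config-step ts eq ◅ reach , eq′

  inked-bits : ∀ v → Inked (map bit v)
  inked-bits []      = []
  inked-bits (_ ∷ v) = refl ∷ inked-bits v

  inked-masked : ∀ as → Inked (map mask as)
  inked-masked []           = []
  inked-masked (blank ∷ as) = refl ∷ inked-masked as
  inked-masked (bit _ ∷ as) = refl ∷ inked-masked as
  inked-masked (aux _ ∷ as) = refl ∷ inked-masked as

  -- The erasing sweep halts at its first blank; ink in one initial stretch guarantees that the rest
  -- of the tape is then clean.
  data Line : Cells → Set where
    blanks : ∀ {cs} → Blanks cs → Line cs
    _∷_    : ∀ {a as} → isBlank a ≡ false → Line as → Line (a ∷ as)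

  line-++ : ∀ {as cs} → Inked as → Line cs → Line (as ++ cs)
  line-++ []       cs = cs
  line-++ (a ∷ as) cs = a ∷ line-++ as cs

  line-ʳ++ : ∀ {as cs} → Inked as → Line cs → Line (as ʳ++ cs)
  line-ʳ++ []       cs = cs
  line-ʳ++ (a ∷ as) cs = line-ʳ++ as (a ∷ cs)

  data Shelf : Tape′ → Set where
    shelf : ∀ {bs rs} → Blanks bs → Line rs → Shelf (mkTape bs blank rs)

  rewindAct-inked : ∀ {a} → isBlank a ≡ false → rewindAct a ≡ (a , left)
  rewindAct-inked {bit _} _ = refl
  rewindAct-inked {aux _} _ = refl

  eraseAct-inked : ∀ {a} → isBlank a ≡ false → eraseAct a ≡ (blank , right)
  eraseAct-inked {bit _} _ = refl
  eraseAct-inked {aux _} _ = refl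

  rewind-swept : ∀ {ls bs a rs} → Inked ls → Blanks bs →
    ∃[ n ] ∃[ bs′ ] (Blanks bs′ ×
      Sweep rewindAct n (move left (mkTape (ls ++ bs) a rs)) (mkTape bs′ blank (ls ʳ++ (a ∷ rs))))
  rewind-swept []       []          = 0 , [] , [] , stop
  rewind-swept []       (refl ∷ bs) = 0 , _ , bs , stop
  rewind-swept (l ∷ ls) bs with n , bs′ , bl , sw ← rewind-swept ls bs =
    suc n , bs′ , bl , go l (rewindAct-inked l) sw

  erase-swept : ∀ {bs rs} → Blanks bs → Line rs → Swept eraseAct (Stack []) (move right (mkTape bs blank rs))
  erase-swept bs (blanks [])          = 0 , _ , stop , stack (refl ∷ bs) []
  erase-swept bs (blanks (refl ∷ cs)) = 0 , _ , stop , stack (refl ∷ bs) cs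
  erase-swept bs (r ∷ rs) with n , t′ , sw , st ← erase-swept (refl ∷ bs) rs =
    suc n , t′ , go r (eraseAct-inked r) sw , st

  -- The head may rest on a genuine blank, which would stop the sweep before the ink on its left.
  -- Writing `mark` there first makes the ink one interval.
  rewind-simulates : ∀ {t t′} → Simulates t t′ → Swept rewindAct Shelf (act (keep mark) t′)
  rewind-simulates (simulates {ls = ls} {rs = rs} _ bs cs)
    with n , bs′ , bl , sw ← rewind-swept (inked-masked ls) bs =
    suc n , _ , go refl refl sw ,
    shelf bl (line-ʳ++ (inked-masked ls) (refl ∷ line-++ (inked-masked rs) (blanks cs)))

  rewinds-simulates : ∀ {k} {ts : Vec _ k} {ts′ : Vec _ k} → Pointwise Simulates ts ts′ →
    VecAll.All (Swept rewindAct Shelf)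
      (Vec.zipWith act (Vec.map (λ _ → keep mark) (Vec.map scanned ts′)) ts′)
  rewinds-simulates []       = []
  rewinds-simulates (s ∷ ss) = rewind-simulates s ∷ rewinds-simulates ss

  erases-shelves : ∀ {k} {ts : Vec _ k} → VecAll.All Shelf ts →
    VecAll.All (Swept eraseAct (Stack [])) (Vec.zipWith act (Vec.map (_, right) (Vec.map scanned ts)) ts)
  erases-shelves []                = []
  erases-shelves (shelf bs rs ∷ ss) = erase-swept bs rs ∷ erases-shelves ss

  rewind-step : ∀ {w i o ts} → allBlank (Vec.map scanned ts) ≡ false →
    ((w , rewind) , i ∷ o ∷ ts) ⟶
    ((w , rewind) , i ∷ o ∷ Vec.zipWith act (Vec.map rewindAct (Vec.map scanned ts)) ts)
  rewind-step eq rewrite eq = refl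

  erase-step : ∀ {w i o l ts} → allBlank (Vec.map scanned ts) ≡ false →
    ((w , erase) , i ∷ o ∷ l ∷ ts) ⟶
    ((w , erase) , i ∷ o ∷ l ∷ Vec.zipWith act (Vec.map eraseAct (Vec.map scanned ts)) ts)
  erase-step eq rewrite eq = refl

  rewind-end : ∀ {w i o l us} → allBlank (Vec.map scanned (l ∷ us)) ≡ true →
    ((w , rewind) , i ∷ o ∷ l ∷ us) ⟶
    ((w , erase) , i ∷ o ∷ l ∷ Vec.zipWith act (Vec.map (_, right) (Vec.map scanned us)) us)
  rewind-end eq rewrite eq = refl

  erase-end : ∀ {w i o l us} → allBlank (Vec.map scanned us) ≡ true →
    ((w , erase) , i ∷ o ∷ l ∷ us) ⟶ ((w , main) , i ∷ o ∷ l ∷ us)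
  erase-end {us = us} eq rewrite eq = keep₃ us

  -- The length tape joins the rewinding, hence the summed bound, but not the erasing, since the key
  -- must survive.
  cleans : ∀ {w i o v l} {us : Vec _ (suc U.extraTapes)} → Swept rewindAct (Stack v) l →
    VecAll.All (Swept rewindAct Shelf) us →
    ∃[ l′ ] ∃[ us′ ] (Stack v l′ × VecAll.All (Stack []) us′ ×
      ((w , rewind) , i ∷ o ∷ l ∷ us) ⟶* ((w , main) , i ∷ o ∷ l′ ∷ us′))
  cleans {w} {i} {o} (n , l′ , sw , st) swept
    with m , us₁ , sws , shelves ← swept-all swept
    with k , us₂ , ers , stacks ← swept-all (erases-shelves shelves)
    with reach₁ , blank₁ ← Sweeping.sweeps rewindAct refl (λ ts → (w , rewind) , i ∷ o ∷ ts)
           (λ _ → rewind-step) (n + m) (sweep-weaken m sw ∷ sweeps-weakenˡ n sws)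
    with reach₂ , blank₂ ← Sweeping.sweeps eraseAct refl (λ ts → (w , erase) , i ∷ o ∷ l′ ∷ ts)
           (λ _ → erase-step) k ers =
    l′ , us₂ , st , stacks ,
    reach₁ ◅◅ rewind-end blank₁ ◅ reach₂ ◅◅ erase-end blank₂ ◅ ε

  -- Decoding a single program.

  -- The unary tally `z` counts off the bits `u`. As these arrive in reverse, pushing them leftwards
  -- restores the reading order. The blank after the tally ends the loop, and that transition also
  -- pushes the second prefix bit.
  loads : ∀ z u {w i s o ls a cs v t us} → length z ≡ length u →
    Reading (u ++ s) i → Blanks cs → Stack v t →
    ∃[ i′ ] ∃[ cs′ ] ∃[ t′ ] (Reading s i′ × Blanks cs′ × Stack (proj₂ w ∷ (u ʳ++ v)) t′ ×
      ((w , load) , i ∷ o ∷ move right (mkTape ls a (map bit z ++ cs)) ∷ t ∷ us) ⟶*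
      ((w , load′) , i′ ∷ o ∷ move left (mkTape (map bit z ʳ++ (a ∷ ls)) blank cs′) ∷ t′ ∷ us))
  loads [] [] {w} {us = us} _ i [] st =
    _ , _ , _ , i , [] , push (proj₂ w) st ,
    keep₄ us ◅ ε
  loads [] [] {w} {us = us} _ i (refl ∷ cs) st =
    _ , _ , _ , i , cs , push (proj₂ w) st ,
    keep₄ us ◅ ε
  loads (_ ∷ z) (b ∷ u) {us = us} eq at cs st
    with i′ , cs′ , t′ , r , bl , st′ , reach ← loads z u (suc-injective eq) (advance-reading _) cs (push b st) =
    i′ , cs′ , t′ , r , bl , st′ ,
    keep₄ us ◅ reach

  copy-ends : ∀ {w i o l t us} {ts : Vec _ U.extraTapes} → readOutput t ≡ [] → Pointwise Simulates (t ∷ ts) us →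
    ((w , copy) , i ∷ o ∷ l ∷ us) ⟶
    ((w , rewind) , i ∷ o ∷ l ∷ Vec.zipWith act (Vec.map (λ _ → keep mark) (Vec.map scanned us)) us)
  copy-ends _ (simulates {a′ = blank} refl _ _ ∷ _) = refl
  copy-ends _ (simulates {a′ = aux (inj₁ _)} refl _ _ ∷ _) = refl
  copy-ends _ (simulates {a′ = mark} refl _ _ ∷ _) = refl

  -- Copying a bit acts on the tape of `U` as a simulated step, rewriting the bit and moving right.
  -- So `Simulates` survives, and the tapes can be rewound from wherever the copy stops.
  copies : ∀ a rs {w i l os ls us} {ts : Vec _ U.extraTapes} →
    Pointwise Simulates (mkTape ls a rs ∷ ts) us →
    ∃[ us′ ] (VecAll.All (Swept rewindAct Shelf) us′ ×
      ((w , copy) , i ∷ mkTape os blank [] ∷ l ∷ us) ⟶*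
      ((w , rewind) , i ∷ mkTape (map bit (leadingBits (a ∷ rs)) ʳ++ os) blank [] ∷ l ∷ us′))
  copies blank   rs ss = _ , rewinds-simulates ss , copy-ends refl ss ◅ ε
  copies (aux _) rs ss = _ , rewinds-simulates ss , copy-ends refl ss ◅ ε
  copies (bit b) []       (s@(simulates eq _ _) ∷ ss) with refl ← unmask-bit eq =
    _ , rewinds-simulates (s′ ∷ ss) ,
    keep₄ _ ◅ copy-ends refl (s′ ∷ ss) ◅ ε
    where s′ = act-simulates (bit b) right s
  copies (bit b) (r ∷ rs) (s@(simulates eq _ _) ∷ ss)
    with refl ← unmask-bit eq
    with us′ , swept , reach ← copies r rs (act-simulates (bit b) right s ∷ ss) =
    us′ , swept , keep₄ _ ◅ reach

  blank-simulates : ∀ {k} {us : Vec _ k} → VecAll.All (Stack []) us →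
    Pointwise Simulates (Vec.replicate k blankTape) us
  blank-simulates []                  = []
  blank-simulates (stack bs cs ∷ sts) = simulates refl bs cs ∷ blank-simulates sts

  map-mask-bit : ∀ v → map mask (map bit v) ≡ map bit v
  map-mask-bit []      = refl
  map-mask-bit (b ∷ v) = cong (bit b ∷_) (map-mask-bit v)

  -- The phase `load′` puts the first prefix bit on the blank before the loaded bits, which
  -- completes an input tape of `U`.
  input-simulates : ∀ {b v t} → Stack v t → Simulates (inputTape (b ∷ v)) (act (keep (bit b)) t)
  input-simulates {b} {v} (stack {cs = cs} bl cl) =
    subst (λ rs → Simulates (inputTape (b ∷ v)) (mkTape _ (bit b) (rs ++ cs))) (map-mask-bit v)
      (simulates refl bl cl)

  bits-ʳ++ : ∀ v {cs : Cells} → map bit v ʳ++ cs ≡ map bit (reverse v) ++ cs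
  bits-ʳ++ v {cs} = trans (ʳ++-defn (map bit v)) (cong (_++ cs) (sym (reverse-map bit v)))

  -- Loading leaves the length head at the right end of the tally; the rewinding meant for the tapes
  -- of `U` brings it back.
  rewind-loaded : ∀ z {bs cs} → Blanks bs → Blanks cs →
    Swept rewindAct (Stack z) (move left (mkTape (map bit z ʳ++ (blank ∷ bs)) blank cs))
  rewind-loaded z {bs} {cs} bl cl rewrite bits-ʳ++ z {blank ∷ bs}
    with n , bs′ , bl′ , sw ← rewind-swept {a = blank} {rs = cs} (inked-bits (reverse z)) (refl ∷ bl)
    rewrite bits-ʳ++ (reverse z) {blank ∷ cs} | reverse-involutive z =
    n , _ , sw , stack bl′ (refl ∷ cl)

  program-step : ∀ {w₁ w₂ r x s z i os l us} → U on w₁ ∷ w₂ ∷ r outputs x →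
    length z ≡ length r → Reading (true ∷ reverse r ++ s) i → Stack z l → VecAll.All (Stack []) us →
    ∃[ i′ ] ∃[ l′ ] ∃[ us′ ] (Reading s i′ × Stack z l′ × VecAll.All (Stack []) us′ ×
      (((w₁ , w₂) , main) , i ∷ mkTape os blank [] ∷ l ∷ us) ⟶*
      (((w₁ , w₂) , main) , i′ ∷ mkTape (map bit x ʳ++ os) blank [] ∷ l′ ∷ us′))
  program-step {w₁} {w₂} {r} {z = z} ((q , t ∷ ts) , h , refl) eq at (stack bl cl) (st ∷ sts)
    with i′ , cs′ , t′ , rd , bl′ , st′ , reach₁ ←
      loads z (reverse r) {w = w₁ , w₂} {a = blank} (trans eq (sym (length-reverse r))) (advance-reading _) cl st
    with us₁ , ss , reach₂ ← run-halts h
      (input-simulates (subst (λ v → Stack (w₂ ∷ v) t′) (reverse-involutive r) st′) ∷ blank-simulates sts)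
    with us₂ , swept , reach₃ ← copies (scanned t) (rights t) ss
    with l′ , us₃ , st₃ , sts₃ , reach₄ ← cleans (rewind-loaded z bl bl′) swept =
    _ , l′ , us₃ , rd , st₃ , sts₃ ,
    keep₃ _ ◅ reach₁ ◅◅
    keep₄ _ ◅ reach₂ ◅◅ reach₃ ◅◅ reach₄

  -- Decoding a whole stream.

  main-run : ∀ {ℓ w s y z i os l us} → Decodes U (ℓ , w) s y →
    length z ≡ ℓ → Reading s i → Stack z l → VecAll.All (Stack []) us →
    ∃[ w′ ] ∃[ i′ ] ∃[ l′ ] ∃[ us′ ] (Reading [] i′ ×
      ((w , main) , i ∷ mkTape os blank [] ∷ l ∷ us) ⟶*
      ((w′ , main) , i′ ∷ mkTape (map bit y ʳ++ os) blank [] ∷ l′ ∷ us′))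
  main-run end _ rd _ _ = _ , _ , _ , _ , rd , ε
  main-run {w = false , false} (advance d) eq at st sts
    with w′ , i′ , l′ , us′ , rd , reach ← main-run d eq (advance-reading _) st sts =
    w′ , i′ , l′ , us′ , rd , keep₃ _ ◅ reach
  main-run {w = false , true} (advance d) eq at st sts
    with w′ , i′ , l′ , us′ , rd , reach ← main-run d eq (advance-reading _) st sts =
    w′ , i′ , l′ , us′ , rd , keep₃ _ ◅ reach
  main-run {w = true , false} (advance d) eq at st sts
    with w′ , i′ , l′ , us′ , rd , reach ← main-run d eq (advance-reading _) st sts =
    w′ , i′ , l′ , us′ , rd , keep₃ _ ◅ reach
  -- Leaving prefix 11 adds a unary digit, which keeps the tally in step with the key.
  main-run {w = true , true} (advance d) eq at st sts
    with w′ , i′ , l′ , us′ , rd , reach ←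
      main-run d (cong suc eq) (advance-reading _) (push true st) sts =
    w′ , i′ , l′ , us′ , rd , keep₃ _ ◅ reach
  -- The collected outputs lie left of the head and are therefore stored in reverse, whence `ʳ++`.
  main-run {os = os} (program {x = x} {y = y} out d) eq rd st sts
    with i₁ , l₁ , us₁ , rd₁ , st₁ , sts₁ , reach₁ ← program-step {os = os} out eq rd st sts
    with w′ , i′ , l′ , us′ , rd′ , reach ← main-run {os = map bit x ʳ++ os} d eq rd₁ st₁ sts₁
    rewrite map-++ (bit {U.Aux ⊎ ⊤}) x y | ++-ʳ++ (map (bit {U.Aux ⊎ ⊤}) x) {map bit y} {os} =
    w′ , i′ , l′ , us′ , rd′ , reach₁ ◅◅ reach

  -- The outputs are copied backwards over the input tape. Overwriting input is harmless, as the
  -- result is read rightwards from the final head position.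
  flush-run : ∀ v {w ls a rs d rs′ l us} →
    ∃[ c ] (((w , flush) , mkTape ls a rs ∷ move left (mkTape (map bit v) d rs′) ∷ l ∷ us) ⟶* c ×
            step c ≡ nothing × result c ≡ leadingBits (map bit v ʳ++ rs))
  flush-run []      {rs = []}    = _ , keep₃ _ ◅ ε , refl , refl
  flush-run []      {rs = _ ∷ _} = _ , keep₃ _ ◅ ε , refl , refl
  flush-run (b ∷ v) {ls = []} with c , reach , halt , out ← flush-run v =
    c , keep₃ _ ◅ reach , halt , out
  flush-run (b ∷ v) {ls = _ ∷ _} with c , reach , halt , out ← flush-run v =
    c , keep₃ _ ◅ reach , halt , out

  blankTapes : ∀ k → VecAll.All (Stack []) (Vec.replicate k blankTape)
  blankTapes zero    = []
  blankTapes (suc k) = stack [] [] ∷ blankTapes k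

  decoder-outputs : ∀ {s y} → Decodes U (0 , false , false) s y → decoder on s outputs y
  decoder-outputs {s} {y} d
    with w , i , l , us , end , reach₁ ←
      main-run {z = []} {os = []} d refl (inputTape-reading s) (stack [] []) (blankTapes _)
    rewrite bits-ʳ++ y {[]} | ++-identityʳ (map (bit {U.Aux ⊎ ⊤}) (reverse y))
    with c , reach₂ , halt , out ← flush-run (reverse y) {rs = []} =
    c , ⟶*-halts (reach₁ ◅◅ keep₃ _ ◅ reach₂) (done halt) ,
    trans out (trans (cong leadingBits eq) (leadingBits-map-bit y))
    where
    eq : map (bit {U.Aux ⊎ ⊤}) (reverse y) ʳ++ [] ≡ map bit y
    eq = trans (bits-ʳ++ (reverse y)) (trans (++-identityʳ _) (cong (map bit) (reverse-involutive y)))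

-- Sorting programs into a stream.

module ∑ = CommutativeMonoidSum +-0-commutativeMonoid

position : ℕ → Key
position zero    = 0 , false , false
position (suc κ) = succKey (position κ)

-- This is 4ℓ plus the binary value of the prefix. Numeric positions turn the cost of advancing into
-- a difference.
index : Key → ℕ
index (zero  , false , false) = 0
index (zero  , false , true)  = 1
index (zero  , true  , false) = 2
index (zero  , true  , true)  = 3
index (suc ℓ , w)             = 4 + index (ℓ , w)

position-index : ∀ ℓ w → position (index (ℓ , w)) ≡ (ℓ , w)
position-index zero    (false , false) = refl
position-index zero    (false , true)  = refl
position-index zero    (true  , false) = refl
position-index zero    (true  , true)  = refl
position-index (suc ℓ) w rewrite position-index ℓ w = succKey⁴ w
  where
  succKey⁴ : ∀ w → succKey (succKey (succKey (succKey (ℓ , w)))) ≡ (suc ℓ , w)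
  succKey⁴ (false , false) = refl
  succKey⁴ (false , true)  = refl
  succKey⁴ (true  , false) = refl
  succKey⁴ (true  , true)  = refl

-- `2 + ℓ` is the length of the whole program, so the position of a minimal program is at most four
-- times the complexity.
index-≤ : ∀ ℓ w → index (ℓ , w) ≤ (2 + ℓ) * 4
index-≤ zero    (false , false) = z≤n
index-≤ zero    (false , true)  = s≤s z≤n
index-≤ zero    (true  , false) = s≤s (s≤s z≤n)
index-≤ zero    (true  , true)  = s≤s (s≤s (s≤s z≤n))
index-≤ (suc ℓ) w               = +-monoʳ-≤ 4 (index-≤ ℓ w)

advances : ∀ {U s y} j κ → Decodes U (position (κ + j)) s y →
           Decodes U (position κ) (replicate j false ++ s) y
advances zero    κ d rewrite +-identityʳ κ = d
advances (suc j) κ d rewrite +-suc κ j = advance (advances j (suc κ) d)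

argmin : ∀ {t} (κ : Fin (suc t) → ℕ) → ∃[ m ] (∀ i → κ m ≤ κ i)
argmin {zero}  κ = 0F , λ { 0F → ≤-refl }
argmin {suc t} κ with m , least ← argmin (κ ∘ suc) with ≤-total (κ 0F) (κ (suc m))
... | inj₁ le = 0F , λ { 0F → ≤-refl ; (suc i) → ≤-trans le (least i) }
... | inj₂ ge = suc m , λ { 0F → ge ; (suc i) → least i }

data Program (U : TuringMachine) (x : BitString) : (k κ : ℕ) → Set where
  program-at : ∀ {w₁ w₂ r κ} → U on w₁ ∷ w₂ ∷ r outputs x →
               position κ ≡ (length r , w₁ , w₂) → Program U x (2 + length r) κ

-- Each program costs one bit less than its length, as its prefix of two bits is
-- replaced by a single 1; the passages from key b to key B cost B ∸ b bits.
prepend : ∀ {U x k κ t b B s y S} → Program U x k κ → b ≤ κ → Decodes U (position κ) s y →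
  length s + t + κ ≤ S + B →
  ∃[ s′ ] (Decodes U (position b) s′ (x ++ y) × length s′ + suc t + b ≤ k + S + B)
prepend {U} {x} {t = t} {b} {B} {s} {y} {S} (program-at {w₁} {w₂} {r} {κ} out eq) b≤κ d bound =
  replicate j false ++ true ∷ reverse r ++ s ,
  advances j b (subst (λ p → Decodes U p _ _) (trans (sym eq) (cong position (sym (m+[n∸m]≡n b≤κ))))
    (program out (subst (λ p → Decodes U p s y) eq d))) ,
  (begin
    length (replicate j false ++ true ∷ reverse r ++ s) + suc t + b
      ≡⟨ cong (λ l → l + suc t + b) lengths ⟩
    j + suc (length r + length s) + suc t + b
      ≡⟨ rearrange j (length r) (length s) t b ⟩
    2 + length r + (length s + t + (b + j))
      ≡⟨ cong (λ i → 2 + length r + (length s + t + i)) (m+[n∸m]≡n b≤κ) ⟩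
    2 + length r + (length s + t + κ)
      ≤⟨ +-monoʳ-≤ (2 + length r) bound ⟩
    2 + length r + (S + B)
      ≡⟨ +-assoc (2 + length r) S B ⟨
    2 + length r + S + B ∎)
  where
  open ≤-Reasoning
  j = κ ∸ b
  lengths : length (replicate j false ++ true ∷ reverse r ++ s) ≡ j + suc (length r + length s)
  lengths = trans (length-++ (replicate j false))
    (cong₂ (λ m n → m + suc n) (length-replicate j)
      (trans (length-++ (reverse r)) (cong (_+ length s) (length-reverse r))))
  rearrange : ∀ j ℓ m t b → j + suc (ℓ + m) + suc t + b ≡ 2 + ℓ + (m + t + (b + j))
  rearrange = solve-∀

-- Selection sort: a program of least position is swapped to the front and the others are streamed
-- from its position on. With `b` on the left and `B` on the right of the bound, the costs of
-- advancing telescope.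
stream : ∀ {U} t b B (x : Fin t → BitString) (k κ : Fin t → ℕ) →
  (∀ i → Program U (x i) (k i) (κ i)) → (∀ i → b ≤ κ i) → (∀ i → κ i ≤ B) → b ≤ B →
  ∃ λ (π : Permutation′ t) → ∃[ s ] (Decodes U (position b) s (concat (tabulate (x ∘ (π ⟨$⟩ʳ_)))) ×
                 length s + t + b ≤ sum (tabulate (k ∘ (π ⟨$⟩ʳ_))) + B)
stream zero    b B x k κ ps b≤ ≤B b≤B = id , [] , end , b≤B
stream {U} (suc t) b B x k κ ps b≤ ≤B b≤B
  with m , least ← argmin κ
  with π , s , d , bound ← stream t (κ m) B (x ∘ (transpose 0F m ⟨$⟩ʳ_) ∘ suc)
         (k ∘ (transpose 0F m ⟨$⟩ʳ_) ∘ suc) (κ ∘ (transpose 0F m ⟨$⟩ʳ_) ∘ suc)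
         (λ i → ps (transpose 0F m ⟨$⟩ʳ suc i)) (λ i → least _) (λ i → ≤B _) (≤B m)
  -- Index 0 is fixed by `lift₀ π` and then sent to `m`, so the chosen program comes first.
  = lift₀ π ∘ₚ transpose 0F m , prepend (ps m) (b≤ m) d bound

sum-tabulate-permute : ∀ {t} (f : Fin t → ℕ) (π : Permutation′ t) →
  sum (tabulate f) ≡ sum (tabulate (f ∘ (π ⟨$⟩ʳ_)))
sum-tabulate-permute f π = trans (sum-tabulate f) (trans (∑.sum-permute f π)
                                                         (sym (sum-tabulate (f ∘ (π ⟨$⟩ʳ_)))))
  where
  sum-tabulate : ∀ {t} (f : Fin t → ℕ) → sum (tabulate f) ≡ ∑.sum f
  sum-tabulate {zero}  f = refl
  sum-tabulate {suc t} f = cong (f 0F +_) (sum-tabulate (f ∘ suc))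

n≤2^n : ∀ n → n ≤ 2 ^ n
n≤2^n zero    = z≤n
n≤2^n (suc n) = begin
  1 + n           ≤⟨ +-mono-≤ (m^n>0 2 n) (n≤2^n n) ⟩
  2 ^ n + 2 ^ n   ≡⟨ cong (2 ^ n +_) (+-identityʳ (2 ^ n)) ⟨
  2 ^ suc n       ∎
  where open ≤-Reasoning

-- Minimal programs and their keys.

module _ (em : ExcludedMiddle 0ℓ) (U : TuringMachine) (univ : IsUniversal U) where

  private
    CU : BitString → ℕ
    CU = C em U univ

  C-minimal : ∀ {x p} → U on p outputs x → CU x ≤ length p
  C-minimal {x} {p} out = IsLeast.minimal (C-isLeast em U univ x) (p , refl , out)

  C-machine : ∀ M → ∃[ c ] (∀ p x → M on p outputs x → CU x ≤ length p + c)
  C-machine M with c , simulate ← univ M = c , λ p x out →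
    let q , q≤ , out′ = simulate p x out in ≤-trans (C-minimal out′) q≤

  -- A program has at most one output, but whether it has any is decided only classically.
  output-bound : ∀ p → ∃[ N ] (∀ x → U on p outputs x → length x < N)
  output-bound p with em {∃[ x ] (U on p outputs x)}
  ... | yes (x , out) = suc (length x) , λ y out′ →
    s≤s (≤-reflexive (cong length (outputs-deterministic out′ out)))
  ... | no none = 0 , λ x out → contradiction (x , out) none

  -- Only the empty program, 0 and 1 lack a prefix of two bits; `N` exceeds the length of all their
  -- outputs.
  program-index : ∃[ N ] (∀ x → N ≤ length x → ∃[ κ ] (Program U x (CU x) κ × κ ≤ CU x * 4))
  program-index
    with N₀ , bound₀ ← output-bound []
    with N₁ , bound₁ ← output-bound (true ∷ [])
    with N₂ , bound₂ ← output-bound (false ∷ []) =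
    N₀ + N₁ + N₂ , λ x N≤ → index-of x N≤ (IsLeast.holds (C-isLeast em U univ x))
    where
    index-of : ∀ x {k} → N₀ + N₁ + N₂ ≤ length x → HasProgramOfLength U x k →
               ∃[ κ ] (Program U x k κ × κ ≤ k * 4)
    index-of x N≤ ([] , _ , out) = contradiction (bound₀ x out)
      (≤⇒≯ (≤-trans (≤-trans (m≤m+n N₀ N₁) (m≤m+n (N₀ + N₁) N₂)) N≤))
    index-of x N≤ (true ∷ [] , _ , out) = contradiction (bound₁ x out)
      (≤⇒≯ (≤-trans (≤-trans (m≤n+m N₁ N₀) (m≤m+n (N₀ + N₁) N₂)) N≤))
    index-of x N≤ (false ∷ [] , _ , out) = contradiction (bound₂ x out)
      (≤⇒≯ (≤-trans (m≤n+m N₂ (N₀ + N₁)) N≤))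
    index-of x N≤ (w₁ ∷ w₂ ∷ r , refl , out) = index (length r , w₁ , w₂) ,
      program-at out (position-index (length r) (w₁ , w₂)) , index-≤ (length r) (w₁ , w₂)

theorem7 : (em : ExcludedMiddle 0ℓ) (U : TuringMachine) (univ : IsUniversal U) →
    ∃[ p ] ∃[ N ] (∀ (n : ℕ) → n ≥ N →
    ∀ (α : ℕ) → α >7log₂ n +6 →
    ∀ (t : ℕ) (x : Fin t → Vec Bool n) →
    MutuallyIndependent (C em U univ) α x →
    t ≤ eval p n * 2 ^ α)
theorem7 em U univ
  with a , C-length ← C-machine em U univ identityMachine
  with c , C-decoder ← C-machine em U univ (Decoder.decoder U)
  with N , key ← program-index em U univ =
  -- The polynomial is 1 + c + 4(n + a), obtained from t ≤ α + c + 4(n + a).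
  suc (c + a * 4) ∷ 4 ∷ [] , N , bound
  where
  bound : ∀ n → n ≥ N → ∀ α → α >7log₂ n +6 → ∀ t (x : Fin t → Vec Bool n) →
    MutuallyIndependent (C em U univ) α x → t ≤ (suc (c + a * 4) + n * (4 + n * 0)) * 2 ^ α
  bound n n≥N α _ t x independent = conclude
    (stream t 0 B string k (proj₁ ∘ keyed) (proj₁ ∘ proj₂ ∘ keyed) (λ _ → z≤n)
      (λ i → ≤-trans (proj₂ (proj₂ (keyed i))) (*-monoˡ-≤ 4 (k-≤ i))) z≤n)
    where
    open ≤-Reasoning

    string : Fin t → BitString
    string i = toList (x i)

    k : Fin t → ℕ
    k i = C em U univ (string i)

    B : ℕ
    -- Complexities are at most n + a by the identity machine, and positions at most four times
    -- that.
    B = (n + a) * 4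

    keyed : ∀ i → ∃[ κ ] (Program U (string i) (k i) κ × κ ≤ k i * 4)
    keyed i = key (string i) (subst (N ≤_) (sym (length-toList (x i))) n≥N)

    k-≤ : ∀ i → k i ≤ n + a
    k-≤ i = subst (λ l → k i ≤ l + a) (length-toList (x i))
      (C-length (string i) (string i) (identityMachine-outputs (string i)))

    rearrange₁ : ∀ s c α B → s + c + α + B ≡ s + (α + (c + B))
    rearrange₁ = solve-∀

    rearrange₂ : ∀ n a c e → e + (c + (n + a) * 4) * e ≡ (suc (c + a * 4) + n * (4 + n * 0)) * e
    rearrange₂ = solve-∀

    conclude : (∃ λ (π : Permutation′ t) → ∃[ s ] (Decodes U (0 , false , false) s (concat (tabulate (string ∘ (π ⟨$⟩ʳ_)))) ×
                 length s + t + 0 ≤ sum (tabulate (k ∘ (π ⟨$⟩ʳ_))) + B)) →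
               t ≤ (suc (c + a * 4) + n * (4 + n * 0)) * 2 ^ α
    conclude (π , s , d , saving) = begin
      -- The unknown stream length bounds the complexity of the concatenation from above, and with
      -- the saving of t bits it is itself bounded by the sum of complexities, so it cancels.
      t                            ≤⟨ +-cancelˡ-≤ (length s) t (α + (c + B)) total ⟩
      α + (c + B)                  ≤⟨ +-mono-≤ (n≤2^n α) (m≤m*n (c + B) (2 ^ α) {{m^n≢0 2 α}}) ⟩
      2 ^ α + (c + B) * 2 ^ α      ≡⟨ rearrange₂ n a c (2 ^ α) ⟩
      (suc (c + a * 4) + n * (4 + n * 0)) * 2 ^ α ∎
      where
      total : length s + t ≤ length s + (α + (c + B))
      total = begin
        length s + t                 ≡⟨ +-identityʳ _ ⟨
        length s + t + 0             ≤⟨ saving ⟩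
        sum (tabulate (k ∘ (π ⟨$⟩ʳ_))) + B
          ≡⟨ cong (_+ B) (sum-tabulate-permute k π) ⟨
        sum (tabulate k) + B
          -- Independence is applied to the sorting permutation.
          ≤⟨ +-monoˡ-≤ B (independent π) ⟩
        C em U univ (concat (tabulate (string ∘ (π ⟨$⟩ʳ_)))) + α + B
          ≤⟨ +-monoˡ-≤ B (+-monoˡ-≤ α (C-decoder s _ (Decoder.decoder-outputs U d))) ⟩
        length s + c + α + B         ≡⟨ rearrange₁ (length s) c α B ⟩
        length s + (α + (c + B))     ∎
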